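{- Let $G=(V,E)$ be a bipartite graph with $B$ butterflies and with $\wedge=\sum_{u\in V}\binom{d_u}{2}>0$ wedges. Let $Y$ be the return value of one iteration of the algorithm WSamp: choose a vertex $u\in V$ with probability $\binom{d_u}{2}/\wedge$, choose two distinct vertices $v,w\in\Gamma_u$ uniformly at random, set $\beta=|\Gamma_v\cap\Gamma_w|-1$, and return $Y=\beta\cdot\wedge/4$. Then $\mathrm{Var}[Y]\le\frac{\wedge}{4}\,(B+p_{1w})$.
   Context: Graphs are finite, simple, bipartite. $\Gamma_v$ is the set of neighbors of $v$, $d_v=|\Gamma_v|$. A wedge is a path of length two. A butterfly is a $2\times2$ biclique (two vertices on each side of the bipartition, all four edges between them present). $B=B(G)$ is the number of butterflies in $G$. $p_{1w}$ is the number of (unordered) pairs of distinct butterflies that share a wedge, i.e. share exactly three vertices and two edges. -}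

module Defs where

open import Data.Bool using (Bool; true; false)
import Data.Bool.Properties as Bool
open import Data.Fin using (Fin; _≟_)
open import Data.Integer as ℤ using (ℤ; +_; 1ℤ)
open import Data.List using (List; []; _∷_; _++_; map; filter; length; concatMap; foldr; allFin; cartesianProduct)
import Data.List.Membership.DecPropositional as DecMembership
open import Data.List.Relation.Unary.All using (All; all?)
open import Data.Nat as ℕ using (ℕ; NonZero)
open import Data.Nat.Combinatorics using (_C_)
open import Data.Nat.ListAction using (sum)
open import Data.Product using (_×_; _,_; uncurry)
open import Data.Product.Properties using (≡-dec)
open import Data.Rational as ℚ using (ℚ; 0ℚ; _/_)
open import Function using (_∘_)
open import Level using (0ℓ)
open import Relation.Binary using (Rel; Symmetric; Decidable; DecidableEquality)
open import Relation.Binary.PropositionalEquality using (_≡_; _≢_)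
open import Relation.Nullary using (Dec; _×-dec_)

-- All lists below that stand for finite sets are duplicate-free, so that
-- length is cardinality and (unorderedPairs xs) lists every two-element subset
-- of xs exactly once.

unorderedPairs : ∀ {A : Set} → List A → List (A × A)
unorderedPairs []       = []
unorderedPairs (x ∷ xs) = map (x ,_) xs ++ unorderedPairs xs

intersection : ∀ {A : Set} → DecidableEquality A → List A → List A → List A
intersection _≟ᴬ_ xs ys = filter (_∈? ys) xs
  where open DecMembership _≟ᴬ_ using (_∈?_)

-- Adjacency is irreflexive because adjacent vertices lie on different sides.

record BipartiteGraph (n : ℕ) : Set₁ where
  field
    Adj       : Rel (Fin n) 0ℓ
    adj?      : Decidable Adj
    adj-sym   : Symmetric Adj
    side      : Fin n → Bool
    bipartite : ∀ {u v} → Adj u v → side u ≢ side v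

-- The quadruple ((a , b) , (c , d)) stands for the vertex sets {a , b} and
-- {c , d} on the two sides of the bipartition.

Quad : ℕ → Set
Quad n = (Fin n × Fin n) × (Fin n × Fin n)

quadVertices : ∀ {n} → Quad n → List (Fin n)
quadVertices ((a , b) , (c , d)) = a ∷ b ∷ c ∷ d ∷ []

-- Each edge is oriented from the first side to the second, so edges of
-- different butterflies can be compared as ordered pairs.

quadEdges : ∀ {n} → Quad n → List (Fin n × Fin n)
quadEdges ((a , b) , (c , d)) = (a , c) ∷ (a , d) ∷ (b , c) ∷ (b , d) ∷ []

SharesWedge : ∀ {n} → Quad n × Quad n → Set
SharesWedge (p , q) =
  length (intersection _≟_ (quadVertices p) (quadVertices q)) ≡ 3 ×
  length (intersection (≡-dec _≟_ _≟_) (quadEdges p) (quadEdges q)) ≡ 2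

sharesWedge? : ∀ {n} (pq : Quad n × Quad n) → Dec (SharesWedge pq)
sharesWedge? (p , q) = (_ ℕ.≟ 3) ×-dec (_ ℕ.≟ 2)

module _ {n : ℕ} (G : BipartiteGraph n) where
  open BipartiteGraph G

  Γ : Fin n → List (Fin n)
  Γ v = filter (adj? v) (allFin n)

  degree : Fin n → ℕ
  degree v = length (Γ v)

  wedges : ℕ
  wedges = sum (map (λ u → degree u C 2) (allFin n))

  sideVertices : Bool → List (Fin n)
  sideVertices s = filter (λ v → side v Bool.≟ s) (allFin n)

  butterflyList : List (Quad n)
  butterflyList =
    filter (all? (uncurry adj?) ∘ quadEdges)
      (cartesianProduct (unorderedPairs (sideVertices false))
                        (unorderedPairs (sideVertices true)))

  butterflies : ℕ
  butterflies = length butterflyList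

  p₁w : ℕ
  p₁w = length (filter sharesWedge? (unorderedPairs butterflyList))

-- Finite distributions as lists of outcomes with their probabilities; an
-- outcome may be listed several times.

Dist : Set → Set
Dist A = List (A × ℚ)

return : ∀ {A : Set} → A → Dist A
return x = (x , ℚ.1ℚ) ∷ []

infixl 1 _>>=_

_>>=_ : ∀ {A B : Set} → Dist A → (A → Dist B) → Dist B
μ >>= f = concatMap (λ (x , p) → map (λ (y , q) → y , p ℚ.* q) (f x)) μ

-- There is no uniform distribution on the empty set; the value [] has total
-- mass 0.

uniform : ∀ {A : Set} → List A → Dist A
uniform []          = []
uniform xs@(_ ∷ _) = map (λ x → x , 1ℤ / length xs) xs

𝔼 : ∀ {A : Set} → Dist A → (A → ℚ) → ℚ
𝔼 μ f = foldr (λ (x , p) s → p ℚ.* f x ℚ.+ s) 0ℚ μ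

mean : Dist ℚ → ℚ
mean μ = 𝔼 μ (λ y → y)

Var : Dist ℚ → ℚ
Var μ = 𝔼 μ (λ y → (y ℚ.- mean μ) ℚ.* (y ℚ.- mean μ))

module _ {n : ℕ} (G : BipartiteGraph n) where

  vertexByWedges : .{{_ : NonZero (wedges G)}} → Dist (Fin n)
  vertexByWedges = map (λ u → u , + (degree G u C 2) / wedges G) (allFin n)

  β : Fin n → Fin n → ℤ
  β v w = + length (intersection _≟_ (Γ G v) (Γ G w)) ℤ.- 1ℤ

  -- A vertex u whose Γ u has no two distinct elements is drawn with
  -- probability 0, so using uniform [] for it leaves the total mass at 1.

  wSamp : .{{_ : NonZero (wedges G)}} → Dist ℚ
  wSamp = do
    u       ← vertexByWedges
    (v , w) ← uniform (unorderedPairs (Γ G u))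
    return ((β v w ℤ.* + wedges G) / 4)

{-# OPTIONS --safe #-}
module Submission where

-- Write c for the number of common neighbours of v and w. The drawn wedge is
-- uniform among all wedges, so the second moment of Y is ∧/16 times the sum of
-- (c − 1)² over the wedges. Since {v , w} is the pair of endpoints of c wedges,
-- this is the sum over pairs of vertices of c (c − 1)² = 2 C(c,2) + 6 C(c,3).
-- Over the pairs of one fixed side, C(c,2) sums to B, and 3 C(c,3) counts the
-- pairs of butterflies that contain v and w and share exactly one further
-- vertex, hence sums to at most p₁w. The two sides together give the bound
-- 4 (B + p₁w) on the sum, and the variance is at most the second moment.

open import Defs
open import Data.Bool using (Bool; true; false; not; if_then_else_)
import Data.Bool.Properties as Bool
open import Data.Fin using (Fin; _≟_)
open import Data.Integer as ℤ using (ℤ; -[1+_]; 1ℤ; ∣_∣)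
import Data.Integer.Properties as ℤ
open import Data.List using (List; []; _∷_; _++_; map; filter; length; allFin; cartesianProduct)
open import Data.List.Properties
  using (map-++; map-∘; map-cong; map-cong-local; length-++; length-map;
         filter-++; filter-none; filter-accept; filter-reject)
import Data.List.Membership.DecPropositional as DecMembership
open import Data.List.Membership.Propositional.Properties using (∈-filter⁺; ∈-filter⁻; ∈-allFin)
open import Data.List.Relation.Unary.All as All using (All; []; _∷_; all?)
import Data.List.Relation.Unary.All.Properties as All
open import Data.List.Relation.Unary.AllPairs using (AllPairs; []; _∷_)
open import Data.List.Relation.Unary.Any using (here; there)
open import Data.List.Relation.Unary.Unique.Propositional using (Unique)
import Data.List.Relation.Unary.Unique.Propositional.Properties as Unique
open import Data.Nat as ℕ using (ℕ; zero; suc; z≤n)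
open import Data.Nat.Combinatorics using (_C_; nC1≡n; nCk+nC[k+1]≡[n+1]C[k+1])
open import Data.Nat.ListAction using (sum)
open import Data.Nat.ListAction.Properties using (sum-++)
import Data.Nat.Properties as ℕ
open import Data.Nat.Tactic.RingSolver using (solve-∀)
open import Data.Product using (_×_; _,_; proj₁; proj₂; uncurry)
open import Data.Product.Properties using (≡-dec)
open import Data.Rational as ℚ using (ℚ; 0ℚ; 1ℚ)
import Data.Rational.Properties as ℚ
open import Data.Rational.Solver using (module +-*-Solver)
open import Data.Rational.Unnormalised as ℚᵘ using (mkℚᵘ; *≡*; *≤*)
import Data.Rational.Unnormalised.Properties as ℚᵘ
open import Data.Sum using (inj₁; inj₂)
open import Function using (_∘_; _⇔_; mk⇔; Equivalence)
open import Level using (0ℓ)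
open import Relation.Binary using (Rel; DecidableEquality)
open import Relation.Binary.PropositionalEquality
  using (_≡_; _≢_; refl; sym; trans; cong; cong₂; module ≡-Reasoning)
open import Relation.Nullary using (Dec; yes; no; does; ¬_; _×-dec_; contradiction)
open import Relation.Nullary.Decidable using (dec-true; dec-false; does-⇔)
open import Relation.Unary using (Pred; Decidable)

private variable
  A B : Set

-- Arithmetic operators denote those of ℕ inside this module; after it, _*_, _≤_
-- and _/_ denote those of ℚ.

module _ where

  open import Data.Nat using (_+_; _*_; _≤_)
  open import Data.Nat.Properties
    using (≤-reflexive; ≤-trans; +-mono-≤; +-monoʳ-≤; *-monoʳ-≤; m≤m+n; m≤n+m;
           +-identityʳ; *-identityˡ; *-identityʳ; *-zeroʳ; *-distribˡ-+; *-distribʳ-+;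
           module ≤-Reasoning)

  -- Indicators and finite sums of natural numbers.

  𝟙 : {P : Set} → Dec P → ℕ
  𝟙 P? = if does P? then 1 else 0

  module _ {P : Set} (P? : Dec P) where

    𝟙-yes : P → 𝟙 P? ≡ 1
    𝟙-yes p rewrite dec-true P? p = refl

    𝟙-no : ¬ P → 𝟙 P? ≡ 0
    𝟙-no ¬p rewrite dec-false P? ¬p = refl

    𝟙-cong : {Q : Set} (Q? : Dec Q) → P ⇔ Q → 𝟙 P? ≡ 𝟙 Q?
    𝟙-cong Q? P⇔Q = cong (if_then 1 else 0) (does-⇔ P⇔Q P? Q?)

    𝟙-× : {Q : Set} (Q? : Dec Q) → 𝟙 (P? ×-dec Q?) ≡ 𝟙 P? * 𝟙 Q?
    𝟙-× Q? with does P?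
    ... | false = refl
    ... | true  = sym (*-identityˡ (𝟙 Q?))

  ∑ : List A → (A → ℕ) → ℕ
  ∑ xs f = sum (map f xs)

  ∑-++ : ∀ xs ys (f : A → ℕ) → ∑ (xs ++ ys) f ≡ ∑ xs f + ∑ ys f
  ∑-++ xs ys f = trans (cong sum (map-++ f xs ys)) (sum-++ (map f xs) (map f ys))

  ∑-map : ∀ (g : A → B) xs (f : B → ℕ) → ∑ (map g xs) f ≡ ∑ xs (f ∘ g)
  ∑-map g xs f = cong sum (sym (map-∘ xs))

  ∑-cong : ∀ (xs : List A) {f g} → (∀ x → f x ≡ g x) → ∑ xs f ≡ ∑ xs g
  ∑-cong xs f≗g = cong sum (map-cong f≗g xs)

  ∑-cong-local : ∀ {xs : List A} {f g} → All (λ x → f x ≡ g x) xs → ∑ xs f ≡ ∑ xs g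
  ∑-cong-local eqs = cong sum (map-cong-local eqs)

  ∑-mono : ∀ {xs : List A} {f g} → All (λ x → f x ≤ g x) xs → ∑ xs f ≤ ∑ xs g
  ∑-mono []         = z≤n
  ∑-mono (le ∷ les) = +-mono-≤ le (∑-mono les)

  ∑-+ : ∀ (xs : List A) f g → ∑ xs (λ x → f x + g x) ≡ ∑ xs f + ∑ xs g
  ∑-+ []       f g = refl
  ∑-+ (x ∷ xs) f g = begin
    f x + g x + ∑ xs (λ y → f y + g y)  ≡⟨ cong (f x + g x +_) (∑-+ xs f g) ⟩
    f x + g x + (∑ xs f + ∑ xs g)       ≡⟨ +-interchange (f x) (g x) (∑ xs f) (∑ xs g) ⟩
    f x + ∑ xs f + (g x + ∑ xs g)       ∎
    where
    open ≡-Reasoning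
    +-interchange : ∀ a b c d → a + b + (c + d) ≡ a + c + (b + d)
    +-interchange = solve-∀

  ∑-*ˡ : ∀ c (xs : List A) f → ∑ xs (λ x → c * f x) ≡ c * ∑ xs f
  ∑-*ˡ c []       f = sym (*-zeroʳ c)
  ∑-*ˡ c (x ∷ xs) f =
    trans (cong (c * f x +_) (∑-*ˡ c xs f)) (sym (*-distribˡ-+ c (f x) (∑ xs f)))

  ∑-*ʳ : ∀ c (xs : List A) f → ∑ xs (λ x → f x * c) ≡ ∑ xs f * c
  ∑-*ʳ c []       f = refl
  ∑-*ʳ c (x ∷ xs) f =
    trans (cong (f x * c +_) (∑-*ʳ c xs f)) (sym (*-distribʳ-+ c (f x) (∑ xs f)))

  ∑-zero : ∀ (xs : List A) → ∑ xs (λ _ → 0) ≡ 0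
  ∑-zero []       = refl
  ∑-zero (_ ∷ xs) = ∑-zero xs

  ∑-swap : ∀ (xs : List A) (ys : List B) (f : A → B → ℕ) → ∑ xs (λ x → ∑ ys (f x)) ≡ ∑ ys (λ y → ∑ xs (λ x → f x y))
  ∑-swap []       ys f = sym (∑-zero ys)
  ∑-swap (x ∷ xs) ys f =
    trans (cong (∑ ys (f x) +_) (∑-swap xs ys f)) (sym (∑-+ ys (f x) (λ y → ∑ xs (λ x′ → f x′ y))))

  ∑-const : ∀ c (xs : List A) → ∑ xs (λ _ → c) ≡ length xs * c
  ∑-const c []       = refl
  ∑-const c (_ ∷ xs) = cong (c +_) (∑-const c xs)

  length≤∑ : ∀ {xs : List A} {f} → All (λ x → 1 ≤ f x) xs → length xs ≤ ∑ xs f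
  length≤∑ {xs = xs} les = ≤-trans (≤-reflexive (sym (trans (∑-const 1 xs) (*-identityʳ _)))) (∑-mono les)

  term≤∑ : ∀ (xs : List A) f → All (λ x → f x ≤ ∑ xs f) xs
  term≤∑ []       f = []
  term≤∑ (x ∷ xs) f = m≤m+n (f x) _ ∷ All.map (λ le → ≤-trans le (m≤n+m _ (f x))) (term≤∑ xs f)

  ∑-cartesianProduct : ∀ (xs : List A) (ys : List B) f →
    ∑ (cartesianProduct xs ys) f ≡ ∑ xs (λ x → ∑ ys (λ y → f (x , y)))
  ∑-cartesianProduct []       ys f = refl
  ∑-cartesianProduct (x ∷ xs) ys f =
    trans (∑-++ (map (x ,_) ys) _ f) (cong₂ _+_ (∑-map (x ,_) ys f) (∑-cartesianProduct xs ys f))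

  module _ {P : Pred A 0ℓ} (P? : Decidable P) where

    ∑-filter : ∀ xs f → ∑ (filter P? xs) f ≡ ∑ xs (λ x → 𝟙 (P? x) * f x)
    ∑-filter []       f = refl
    ∑-filter (x ∷ xs) f with does (P? x)
    ... | false = ∑-filter xs f
    ... | true  = cong₂ _+_ (sym (+-identityʳ (f x))) (∑-filter xs f)

    length-filter-∑ : ∀ xs → length (filter P? xs) ≡ ∑ xs (𝟙 ∘ P?)
    length-filter-∑ []       = refl
    length-filter-∑ (x ∷ xs) with does (P? x)
    ... | false = length-filter-∑ xs
    ... | true  = cong suc (length-filter-∑ xs)

  -- Sums over unordered pairs.

  ∑-pairs-++ : ∀ (xs ys : List A) f →
    ∑ (unorderedPairs (xs ++ ys)) f ≡
    ∑ (unorderedPairs xs) f + (∑ xs (λ x → ∑ ys (λ y → f (x , y))) + ∑ (unorderedPairs ys) f)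
  ∑-pairs-++ []       ys f = refl
  ∑-pairs-++ (x ∷ xs) ys f = begin
    ∑ (map (x ,_) (xs ++ ys) ++ unorderedPairs (xs ++ ys)) f
      ≡⟨ ∑-++ (map (x ,_) (xs ++ ys)) _ f ⟩
    ∑ (map (x ,_) (xs ++ ys)) f + ∑ (unorderedPairs (xs ++ ys)) f
      ≡⟨ cong₂ _+_ row (∑-pairs-++ xs ys f) ⟩
    X + Y + (P + (R + Q))
      ≡⟨ rearrange X Y P R Q ⟩
    X + P + (Y + R + Q)
      ≡⟨ cong (_+ (Y + R + Q)) (∑-++ (map (x ,_) xs) _ f) ⟨
    ∑ (unorderedPairs (x ∷ xs)) f + (Y + R + Q) ∎
    where
    open ≡-Reasoning
    X = ∑ (map (x ,_) xs) f
    Y = ∑ ys (λ y → f (x , y))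
    P = ∑ (unorderedPairs xs) f
    Q = ∑ (unorderedPairs ys) f
    R = ∑ xs (λ x → ∑ ys (λ y → f (x , y)))
    row : ∑ (map (x ,_) (xs ++ ys)) f ≡ X + Y
    row = trans (cong (λ zs → ∑ zs f) (map-++ (x ,_) xs ys))
         (trans (∑-++ (map (x ,_) xs) _ f) (cong (X +_) (∑-map (x ,_) ys f)))
    rearrange : ∀ a b c d e → a + b + (c + (d + e)) ≡ a + c + (b + d + e)
    rearrange = solve-∀

  unorderedPairs-map : ∀ (g : A → B) xs →
    unorderedPairs (map g xs) ≡ map (λ (x , y) → g x , g y) (unorderedPairs xs)
  unorderedPairs-map g []       = refl
  unorderedPairs-map g (x ∷ xs) = begin
    map (g x ,_) (map g xs) ++ unorderedPairs (map g xs)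
      ≡⟨ cong₂ _++_ (trans (sym (map-∘ xs)) (map-∘ xs)) (unorderedPairs-map g xs) ⟩
    map g² (map (x ,_) xs) ++ map g² (unorderedPairs xs)
      ≡⟨ map-++ g² (map (x ,_) xs) _ ⟨
    map g² (unorderedPairs (x ∷ xs)) ∎
    where
    open ≡-Reasoning
    g² = λ (x , y) → g x , g y

  ∑-pairs-map : ∀ (g : A → B) xs f →
    ∑ (unorderedPairs (map g xs)) f ≡ ∑ (unorderedPairs xs) (λ (x , y) → f (g x , g y))
  ∑-pairs-map g xs f =
    trans (cong (λ ps → ∑ ps f) (unorderedPairs-map g xs)) (∑-map _ (unorderedPairs xs) f)

  length-unorderedPairs : ∀ (xs : List A) → length (unorderedPairs xs) ≡ length xs C 2
  length-unorderedPairs []       = refl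
  length-unorderedPairs (x ∷ xs) = begin
    length (map (x ,_) xs ++ unorderedPairs xs)        ≡⟨ length-++ (map (x ,_) xs) ⟩
    length (map (x ,_) xs) + length (unorderedPairs xs)
      ≡⟨ cong₂ _+_ (trans (length-map (x ,_) xs) (sym (nC1≡n _))) (length-unorderedPairs xs) ⟩
    length xs C 1 + length xs C 2                      ≡⟨ nCk+nC[k+1]≡[n+1]C[k+1] (length xs) 1 ⟩
    suc (length xs) C 2                                ∎
    where open ≡-Reasoning

  unorderedPairs⁺ : ∀ {R : Rel A 0ℓ} {xs} → AllPairs R xs → All (uncurry R) (unorderedPairs xs)
  unorderedPairs⁺ []         = []
  unorderedPairs⁺ (rx ∷ rxs) = All.++⁺ (All.map⁺ rx) (unorderedPairs⁺ rxs)

  All⇒AllPairs : ∀ {P : Pred A 0ℓ} {xs} → All P xs → AllPairs (λ x y → P x × P y) xs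
  All⇒AllPairs []         = []
  All⇒AllPairs (px ∷ pxs) = All.map (px ,_) pxs ∷ All⇒AllPairs pxs

  -- The quantifier over `f` stands inside `All` because `∑-meetingPairs` applies the bound to a
  -- summand that depends on the pair itself.
  pairTerms≤∑ : ∀ (xs : List A) → All (λ (x , y) → ∀ f → f x + f y ≤ ∑ xs f) (unorderedPairs xs)
  pairTerms≤∑ []       = []
  pairTerms≤∑ (x ∷ xs) = All.++⁺
    (All.map⁺ (All.tabulate λ y∈xs f → +-monoʳ-≤ (f x) (All.lookup (term≤∑ xs f) y∈xs)))
    (All.map (λ le f → ≤-trans (le f) (m≤n+m _ (f x))) (pairTerms≤∑ xs))

  module _ {P : Pred A 0ℓ} {R : Pred (A × A) 0ℓ} (P? : Decidable P) (R? : Decidable R)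
           (R⇔P×P : ∀ {x y} → R (x , y) ⇔ (P x × P y)) where

    private
      to : ∀ {x y} → R (x , y) → P x × P y
      to = Equivalence.to R⇔P×P

      filter-row : ∀ {x} → P x → ∀ ys → filter R? (map (x ,_) ys) ≡ map (x ,_) (filter P? ys)
      filter-row     px []       = refl
      filter-row {x} px (y ∷ ys) with P? y
      ... | yes py = trans (filter-accept R? (Equivalence.from R⇔P×P (px , py))) (cong (_ ∷_) (filter-row px ys))
      ... | no ¬py = trans (filter-reject R? (¬py ∘ proj₂ ∘ to)) (filter-row px ys)

    -- `R?` may be any test equivalent to testing both components. This covers the biclique test,
    -- which is not literally a conjunction of two tests on vertices.
    filter-unorderedPairs : ∀ xs → filter R? (unorderedPairs xs) ≡ unorderedPairs (filter P? xs)
    filter-unorderedPairs []       = refl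
    filter-unorderedPairs (x ∷ xs) with P? x
    ... | yes px = trans (filter-++ R? (map (x ,_) xs) _)
                         (cong₂ _++_ (filter-row px xs) (filter-unorderedPairs xs))
    ... | no ¬px = trans (filter-++ R? (map (x ,_) xs) _)
                         (cong₂ _++_ (filter-none R? (All.map⁺ (All.universal (λ _ → ¬px ∘ proj₁ ∘ to) xs)))
                                     (filter-unorderedPairs xs))

  ∑-pairs-filter : ∀ {P : Pred A 0ℓ} (P? : Decidable P) xs f →
    ∑ (unorderedPairs (filter P? xs)) f ≡
    ∑ (unorderedPairs xs) (λ (x , y) → 𝟙 (P? x ×-dec P? y) * f (x , y))
  ∑-pairs-filter P? xs f = trans
    (cong (λ ps → ∑ ps f) (sym (filter-unorderedPairs P? P²? (mk⇔ (λ p → p) (λ p → p)) xs)))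
    (∑-filter P²? (unorderedPairs xs) f)
    where P²? = λ (x , y) → P? x ×-dec P? y

  -- Pairs of entries of a product that agree in one component.

  module _ {X Y : Set} (f : (X × Y) × (X × Y) → ℕ) where

    open ≤-Reasoning

    -- Two entries with the same first component lie in one row of the product, in the order of
    -- `ys`. The pairs across different rows are dropped.
    ∑-pairs-equal-fst : ∀ xs ys →
      ∑ xs (λ x → ∑ (unorderedPairs ys) (λ (y , y′) → f ((x , y) , (x , y′)))) ≤
      ∑ (unorderedPairs (cartesianProduct xs ys)) f
    ∑-pairs-equal-fst []       ys = z≤n
    ∑-pairs-equal-fst (x ∷ xs) ys = begin
      _ ≤⟨ +-mono-≤ (≤-reflexive (sym (∑-pairs-map (x ,_) ys f)))
                    (≤-trans (∑-pairs-equal-fst xs ys) (m≤n+m _ _)) ⟩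
      _ ≡⟨ ∑-pairs-++ (map (x ,_) ys) (cartesianProduct xs ys) f ⟨
      ∑ (unorderedPairs (cartesianProduct (x ∷ xs) ys)) f ∎

    -- Two entries with the same second component lie in different rows, so the pairs that involve
    -- the first row are found in the cross term of `∑-pairs-++`. The pairs inside a row are
    -- dropped.
    ∑-pairs-equal-snd : ∀ xs ys →
      ∑ ys (λ y → ∑ (unorderedPairs xs) (λ (x , x′) → f ((x , y) , (x′ , y)))) ≤
      ∑ (unorderedPairs (cartesianProduct xs ys)) f
    ∑-pairs-equal-snd []       ys = ≤-reflexive (∑-zero ys)
    ∑-pairs-equal-snd (x ∷ xs) ys = begin
      ∑ ys (λ y → ∑ (unorderedPairs (x ∷ xs)) (λ (x , x′) → f ((x , y) , (x′ , y))))
        ≡⟨ ∑-cong ys (λ y → trans (∑-++ (map (x ,_) xs) _ _) (cong (_+ _) (∑-map (x ,_) xs _))) ⟩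
      ∑ ys (λ y → ∑ xs (λ x′ → f ((x , y) , (x′ , y))) + rest y)
        ≡⟨ ∑-+ ys _ rest ⟩
      ∑ ys (λ y → ∑ xs (λ x′ → f ((x , y) , (x′ , y)))) + ∑ ys rest
        ≤⟨ +-mono-≤ row (∑-pairs-equal-snd xs ys) ⟩
      ∑ (map (x ,_) ys) (λ b → ∑ (cartesianProduct xs ys) (λ b′ → f (b , b′))) + _
        ≤⟨ m≤n+m _ (∑ (unorderedPairs (map (x ,_) ys)) f) ⟩
      _ ≡⟨ ∑-pairs-++ (map (x ,_) ys) (cartesianProduct xs ys) f ⟨
      ∑ (unorderedPairs (cartesianProduct (x ∷ xs) ys)) f ∎
      where
      rest = λ y → ∑ (unorderedPairs xs) (λ (x , x′) → f ((x , y) , (x′ , y)))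
      row : ∑ ys (λ y → ∑ xs (λ x′ → f ((x , y) , (x′ , y)))) ≤
            ∑ (map (x ,_) ys) (λ b → ∑ (cartesianProduct xs ys) (λ b′ → f (b , b′)))
      row = begin
        ∑ ys (λ y → ∑ xs (λ x′ → f ((x , y) , (x′ , y))))
          -- The wanted summand is the term with `y′` equal to `y` in a sum over all `y′`.
          ≤⟨ ∑-mono (All.tabulate λ {y} y∈ys →
               ∑-mono (All.universal (λ x′ → All.lookup (term≤∑ ys (λ y′ → f ((x , y) , (x′ , y′)))) y∈ys) xs)) ⟩
        ∑ ys (λ y → ∑ xs (λ x′ → ∑ ys (λ y′ → f ((x , y) , (x′ , y′)))))
          ≡⟨ ∑-cong ys (λ y → ∑-cartesianProduct xs ys (λ b′ → f ((x , y) , b′))) ⟨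
        ∑ ys (λ y → ∑ (cartesianProduct xs ys) (λ b′ → f ((x , y) , b′)))
          ≡⟨ ∑-map (x ,_) ys _ ⟨
        _ ∎

  -- Two-element subsets that meet in exactly one point.

  module _ {A : Set} (_≟_ : DecidableEquality A) where

    open DecMembership _≟_ using (_∈_; _∈?_)

    commonCount : A × A → A × A → ℕ
    commonCount (x , y) (c , d) = 𝟙 (x ∈? (c ∷ d ∷ [])) + 𝟙 (y ∈? (c ∷ d ∷ []))

    private
      𝟙-∈ : ∀ {x c d} → x ∈ (c ∷ d ∷ []) → 𝟙 (x ∈? (c ∷ d ∷ [])) ≡ 1
      𝟙-∈ {x} {c} {d} = 𝟙-yes (x ∈? (c ∷ d ∷ []))

      𝟙-∉ : ∀ {x c d : A} → x ≢ c → x ≢ d → 𝟙 (x ∈? (c ∷ d ∷ [])) ≡ 0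
      𝟙-∉ {x} {c} {d} x≢c x≢d = 𝟙-no (x ∈? (c ∷ d ∷ [])) λ where
        (here x≡c)         → x≢c x≡c
        (there (here x≡d)) → x≢d x≡d

    -- Each three-element subset contains three two-element subsets, and any two of these meet in
    -- exactly one point. In the induction a new element `x` forms a triple with every pair
    -- `{y , z}` of the rest. Of the three pairs of subsets in that triple, one has both members
    -- through `x`, and the other two match `{y , z}` with a set through `x`. The predicate `S`
    -- hands the side conditions of the application on to `h≥1`.
    ∑-meetingPairs : ∀ {S : Pred A 0ℓ} (h : (A × A) × (A × A) → ℕ) →
      (∀ {x y q} → S x → S y → commonCount (x , y) q ≡ 1 → 1 ≤ h ((x , y) , q)) →
      ∀ {xs} → All S xs → Unique xs →
      3 * (length xs C 3) ≤ ∑ (unorderedPairs (unorderedPairs xs)) h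
    ∑-meetingPairs h h≥1 {[]}     []         []           = z≤n
    ∑-meetingPairs {S} h h≥1 {x ∷ xs} (sx ∷ sxs) (x∉xs ∷ xs!) = begin
      3 * (suc m C 3)                    ≡⟨ cong (3 *_) (nCk+nC[k+1]≡[n+1]C[k+1] m 2) ⟨
      3 * (m C 2 + m C 3)                ≡⟨ split (m C 2) (m C 3) ⟩
      m C 2 + ((m C 2) * 2 + 3 * (m C 3))
        ≤⟨ +-mono-≤ through-x (+-mono-≤ meeting-x (∑-meetingPairs h h≥1 sxs xs!)) ⟩
      _                                  ≡⟨ ∑-pairs-++ (map (x ,_) xs) (unorderedPairs xs) h ⟨
      ∑ (unorderedPairs (unorderedPairs (x ∷ xs))) h ∎
      where
      open ≤-Reasoning
      m = length xs
      split : ∀ a b → 3 * (a + b) ≡ a + (a * 2 + 3 * b)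
      split = solve-∀
      distinct : All (λ (y , z) → (y ≢ z) × ((S y × x ≢ y) × (S z × x ≢ z))) (unorderedPairs xs)
      distinct = All.zip (unorderedPairs⁺ xs! , unorderedPairs⁺ (All⇒AllPairs (All.zip (sxs , x∉xs))))
      through-x : m C 2 ≤ ∑ (unorderedPairs (map (x ,_) xs)) h
      through-x = begin
        m C 2                        ≡⟨ length-unorderedPairs xs ⟨
        length (unorderedPairs xs)   ≤⟨ length≤∑ (All.map (λ (y≢z , (sy , x≢y) , _) →
                                          h≥1 sx sy (cong₂ _+_ (𝟙-∈ (here refl))
                                                               (𝟙-∉ (x≢y ∘ sym) y≢z)))
                                        distinct) ⟩
        _                            ≡⟨ ∑-pairs-map (x ,_) xs h ⟨
        _                            ∎
      meeting-x : (m C 2) * 2 ≤ ∑ (map (x ,_) xs) (λ p → ∑ (unorderedPairs xs) (λ q → h (p , q)))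
      meeting-x = begin
        (m C 2) * 2                               ≡⟨ cong (_* 2) (length-unorderedPairs xs) ⟨
        length (unorderedPairs xs) * 2          ≡⟨ ∑-const 2 (unorderedPairs xs) ⟨
        ∑ (unorderedPairs xs) (λ _ → 2)
          -- For `q` equal to `{y , z}`, both `{x , y}` and `{x , z}` meet `q` in one point. These
          -- are two different terms of the sum over `xs`.
          ≤⟨ ∑-mono (All.zipWith (λ (le , (y≢z , (sy , x≢y) , (sz , x≢z))) →
               ≤-trans (+-mono-≤ (h≥1 sx sy (cong₂ _+_ (𝟙-∉ x≢y x≢z) (𝟙-∈ (here refl))))
                                 (h≥1 sx sz (cong₂ _+_ (𝟙-∉ x≢y x≢z) (𝟙-∈ (there (here refl))))))
                       (le (λ u → h ((x , u) , _))))
               (pairTerms≤∑ xs , distinct)) ⟩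
        ∑ (unorderedPairs xs) (λ q → ∑ xs (λ y → h ((x , y) , q)))
          ≡⟨ ∑-swap xs (unorderedPairs xs) _ ⟨
        ∑ xs (λ y → ∑ (unorderedPairs xs) (λ q → h ((x , y) , q)))
          ≡⟨ ∑-map (x ,_) xs _ ⟨
        _ ∎

  -- The square of β for a pair with k common neighbours; the junk value 1 at k = 0
  -- never matters because it only occurs multiplied by k.

  [β]² : ℕ → ℕ
  [β]² k = ∣ ℤ.+ k ℤ.- 1ℤ ∣ * ∣ ℤ.+ k ℤ.- 1ℤ ∣

  -- The binomial form of n (n - 1)².

  2*[1+n]C2 : ∀ n → 2 * (suc n C 2) ≡ suc n * n
  2*[1+n]C2 zero    = refl
  2*[1+n]C2 (suc n) = begin
    2 * (suc (suc n) C 2)              ≡⟨ cong (2 *_) (nCk+nC[k+1]≡[n+1]C[k+1] (suc n) 1) ⟨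
    2 * (suc n C 1 + suc n C 2)        ≡⟨ cong (λ a → 2 * (a + suc n C 2)) (nC1≡n (suc n)) ⟩
    2 * (suc n + suc n C 2)            ≡⟨ *-distribˡ-+ 2 (suc n) (suc n C 2) ⟩
    2 * suc n + 2 * (suc n C 2)        ≡⟨ cong (2 * suc n +_) (2*[1+n]C2 n) ⟩
    2 * suc n + suc n * n              ≡⟨ poly n ⟩
    suc (suc n) * suc n                ∎
    where
    open ≡-Reasoning
    poly : ∀ n → 2 * suc n + suc n * n ≡ suc (suc n) * suc n
    poly = solve-∀

  6*[2+n]C3 : ∀ n → 6 * (suc (suc n) C 3) ≡ suc (suc n) * suc n * n
  6*[2+n]C3 zero    = refl
  6*[2+n]C3 (suc n) = begin
    6 * (suc (suc (suc n)) C 3)        ≡⟨ cong (6 *_) (nCk+nC[k+1]≡[n+1]C[k+1] (suc (suc n)) 2) ⟨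
    6 * (t + suc (suc n) C 3)          ≡⟨ split t (suc (suc n) C 3) ⟩
    3 * (2 * t) + 6 * (suc (suc n) C 3)
      ≡⟨ cong₂ (λ a b → 3 * a + b) (2*[1+n]C2 (suc n)) (6*[2+n]C3 n) ⟩
    3 * (suc (suc n) * suc n) + suc (suc n) * suc n * n  ≡⟨ poly n ⟩
    suc (suc (suc n)) * suc (suc n) * suc n ∎
    where
    open ≡-Reasoning
    t = suc (suc n) C 2
    split : ∀ a b → 6 * (a + b) ≡ 3 * (2 * a) + 6 * b
    split = solve-∀
    poly : ∀ n → 3 * (suc (suc n) * suc n) + suc (suc n) * suc n * n ≡
                 suc (suc (suc n)) * suc (suc n) * suc n
    poly = solve-∀

  -- Splitting one factor n - 1 as 1 + (n - 2) gives n (n - 1)² = n (n - 1) + n (n - 1) (n - 2).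
  -- From 2 on, `∣ + n - 1 ∣` computes to the predecessor, so the identity is polynomial.
  n*[β]² : ∀ n → n * [β]² n ≡ 2 * (n C 2) + 6 * (n C 3)
  n*[β]² zero          = refl
  n*[β]² (suc zero)    = refl
  n*[β]² (suc (suc n)) = sym (trans (cong₂ _+_ (2*[1+n]C2 (suc n)) (6*[2+n]C3 n)) (poly n))
    where
    poly : ∀ n → suc (suc n) * suc n + suc (suc n) * suc n * n ≡ suc (suc n) * (suc n * suc n)
    poly = solve-∀

  -- Butterflies that agree on one side and share a wedge.

  module _ {n : ℕ} where

    open DecMembership (_≟_ {n}) using (_∈?_; _∈_)
    open DecMembership (≡-dec (_≟_ {n}) (_≟_ {n})) using () renaming (_∈_ to _∈ᴱ_; _∈?_ to _∈ᴱ?_)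

    private
      variable v w x y c d : Fin n

      ∈-vertices₁ : x ≢ v → x ≢ w → x ∈ (v ∷ w ∷ c ∷ d ∷ []) ⇔ x ∈ (c ∷ d ∷ [])
      ∈-vertices₁ x≢v x≢w = mk⇔
        (λ { (here x≡v) → contradiction x≡v x≢v
           ; (there (here x≡w)) → contradiction x≡w x≢w
           ; (there (there x∈)) → x∈ })
        (there ∘ there)

      ∈-vertices₂ : x ≢ v → x ≢ w → x ∈ (c ∷ d ∷ v ∷ w ∷ []) ⇔ x ∈ (c ∷ d ∷ [])
      ∈-vertices₂ x≢v x≢w = mk⇔
        (λ { (here x≡c) → here x≡c
           ; (there (here x≡d)) → there (here x≡d)
           ; (there (there (here x≡v))) → contradiction x≡v x≢v
           ; (there (there (there (here x≡w)))) → contradiction x≡w x≢w })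
        (λ { (here x≡c) → here x≡c
           ; (there (here x≡d)) → there (here x≡d) })

    -- The shared wedge has its centre at the single common vertex of the two varying pairs and its
    -- ends at `v` and `w`. `SharesWedge` compares vertex lists without regard to sides, so the
    -- inequalities ensure that `x` and `y` are matched only with entries of `q`.
    sharesWedge-fst : ∀ {v w x y q} → x ≢ v × x ≢ w → y ≢ v × y ≢ w →
      commonCount _≟_ (x , y) q ≡ 1 → SharesWedge (((v , w) , (x , y)) , ((v , w) , q))
    sharesWedge-fst {v} {w} {x} {y} {c , d} (x≢v , x≢w) (y≢v , y≢w) i+j≡1 =
      trans (length-filter-∑ (_∈? vs) (v ∷ w ∷ x ∷ y ∷ []))
        (trans (cong₂ _+_ (𝟙-yes (v ∈? vs) (here refl))
               (cong₂ _+_ (𝟙-yes (w ∈? vs) (there (here refl)))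
               (cong₂ (λ i j → i + (j + 0))
                          (𝟙-cong (x ∈? vs) (x ∈? cd) (∈-vertices₁ x≢v x≢w))
                          (𝟙-cong (y ∈? vs) (y ∈? cd) (∈-vertices₁ y≢v y≢w)))))
               (trans (vertexCount (𝟙 (x ∈? cd)) (𝟙 (y ∈? cd))) (cong (2 +_) i+j≡1))) ,
      trans (length-filter-∑ (_∈ᴱ? es) ((v , x) ∷ (v , y) ∷ (w , x) ∷ (w , y) ∷ []))
        (trans (cong₂ _+_ (𝟙-cong ((v , x) ∈ᴱ? es) (x ∈? cd) v∼)
               (cong₂ _+_ (𝟙-cong ((v , y) ∈ᴱ? es) (y ∈? cd) v∼)
               (cong₂ (λ i j → i + (j + 0))
                          (𝟙-cong ((w , x) ∈ᴱ? es) (x ∈? cd) w∼)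
                          (𝟙-cong ((w , y) ∈ᴱ? es) (y ∈? cd) w∼))))
               (trans (edgeCount (𝟙 (x ∈? cd)) (𝟙 (y ∈? cd))) (cong (2 *_) i+j≡1)))
      where
      cd = c ∷ d ∷ []
      vs = v ∷ w ∷ c ∷ d ∷ []
      es = (v , c) ∷ (v , d) ∷ (w , c) ∷ (w , d) ∷ []
      -- The last two clauses of the forward direction cover the case in which `v` and `w` coincide.
      v∼ : ∀ {z} → (v , z) ∈ᴱ es ⇔ z ∈ cd
      v∼ = mk⇔ (λ { (here refl) → here refl ; (there (here refl)) → there (here refl)
                  ; (there (there (here refl))) → here refl
                  ; (there (there (there (here refl)))) → there (here refl) })
               (λ { (here refl) → here refl ; (there (here refl)) → there (here refl) })
      w∼ : ∀ {z} → (w , z) ∈ᴱ es ⇔ z ∈ cd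
      w∼ = mk⇔ (λ { (here refl) → here refl ; (there (here refl)) → there (here refl)
                  ; (there (there (here refl))) → here refl
                  ; (there (there (there (here refl)))) → there (here refl) })
               (λ { (here refl) → there (there (here refl))
                  ; (there (here refl)) → there (there (there (here refl))) })
      vertexCount : ∀ i j → 1 + (1 + (i + (j + 0))) ≡ 2 + (i + j)
      vertexCount = solve-∀
      edgeCount : ∀ i j → i + (j + (i + (j + 0))) ≡ 2 * (i + j)
      edgeCount = solve-∀

    -- The mirror image of `sharesWedge-fst`. The fixed orientation of `Quad` changes the order of
    -- vertices and edges, hence the separate count.
    sharesWedge-snd : ∀ {v w x y q} → x ≢ v × x ≢ w → y ≢ v × y ≢ w →
      commonCount _≟_ (x , y) q ≡ 1 → SharesWedge (((x , y) , (v , w)) , (q , (v , w)))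
    sharesWedge-snd {v} {w} {x} {y} {c , d} (x≢v , x≢w) (y≢v , y≢w) i+j≡1 =
      trans (length-filter-∑ (_∈? vs) (x ∷ y ∷ v ∷ w ∷ []))
        (trans (cong₂ _+_ (𝟙-cong (x ∈? vs) (x ∈? cd) (∈-vertices₂ x≢v x≢w))
               (cong₂ _+_ (𝟙-cong (y ∈? vs) (y ∈? cd) (∈-vertices₂ y≢v y≢w))
               (cong₂ (λ i j → i + (j + 0))
                          (𝟙-yes (v ∈? vs) (there (there (here refl))))
                          (𝟙-yes (w ∈? vs) (there (there (there (here refl))))))))
               (trans (vertexCount (𝟙 (x ∈? cd)) (𝟙 (y ∈? cd))) (cong (2 +_) i+j≡1))) ,
      trans (length-filter-∑ (_∈ᴱ? es) ((x , v) ∷ (x , w) ∷ (y , v) ∷ (y , w) ∷ []))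
        (trans (cong₂ _+_ (𝟙-cong ((x , v) ∈ᴱ? es) (x ∈? cd) ∼v)
               (cong₂ _+_ (𝟙-cong ((x , w) ∈ᴱ? es) (x ∈? cd) ∼w)
               (cong₂ (λ i j → i + (j + 0))
                          (𝟙-cong ((y , v) ∈ᴱ? es) (y ∈? cd) ∼v)
                          (𝟙-cong ((y , w) ∈ᴱ? es) (y ∈? cd) ∼w))))
               (trans (edgeCount (𝟙 (x ∈? cd)) (𝟙 (y ∈? cd))) (cong (2 *_) i+j≡1)))
      where
      cd = c ∷ d ∷ []
      vs = c ∷ d ∷ v ∷ w ∷ []
      es = (c , v) ∷ (c , w) ∷ (d , v) ∷ (d , w) ∷ []
      ∼v : ∀ {z} → (z , v) ∈ᴱ es ⇔ z ∈ cd
      ∼v = mk⇔ (λ { (here refl) → here refl ; (there (here refl)) → here refl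
                  ; (there (there (here refl))) → there (here refl)
                  ; (there (there (there (here refl)))) → there (here refl) })
               (λ { (here refl) → here refl ; (there (here refl)) → there (there (here refl)) })
      ∼w : ∀ {z} → (z , w) ∈ᴱ es ⇔ z ∈ cd
      ∼w = mk⇔ (λ { (here refl) → here refl ; (there (here refl)) → here refl
                  ; (there (there (here refl))) → there (here refl)
                  ; (there (there (there (here refl)))) → there (here refl) })
               (λ { (here refl) → there (here refl)
                  ; (there (here refl)) → there (there (there (here refl))) })
      vertexCount : ∀ i j → i + (j + (1 + (1 + 0))) ≡ 2 + (i + j)
      vertexCount = solve-∀
      edgeCount : ∀ i j → i + (i + (j + (j + 0))) ≡ 2 * (i + j)
      edgeCount = solve-∀

  -- Codegrees and the double counting of wedges.

  module _ {n : ℕ} (G : BipartiteGraph n) where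

    open BipartiteGraph G
    open DecMembership (_≟_ {n}) using (_∈?_)

    codegree : Fin n → Fin n → ℕ
    codegree v w = length (intersection _≟_ (Γ G v) (Γ G w))

    private
      V = allFin n
      common? = λ v w x → adj? v x ×-dec adj? w x

    codegree-∑ : ∀ v w → codegree v w ≡ ∑ V (λ x → 𝟙 (common? v w x))
    codegree-∑ v w = begin
      length (filter (_∈? Γ G w) (filter (adj? v) V))    ≡⟨ length-filter-∑ (_∈? Γ G w) (Γ G v) ⟩
      ∑ (filter (adj? v) V) (λ x → 𝟙 (x ∈? Γ G w))       ≡⟨ ∑-filter (adj? v) V _ ⟩
      ∑ V (λ x → 𝟙 (adj? v x) * 𝟙 (x ∈? Γ G w))
        ≡⟨ ∑-cong V (λ x → trans
             (cong (𝟙 (adj? v x) *_) (𝟙-cong (x ∈? Γ G w) (adj? w x)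
               (mk⇔ (proj₂ ∘ ∈-filter⁻ (adj? w) {xs = V}) (∈-filter⁺ (adj? w) (∈-allFin x)))))
             (sym (𝟙-× (adj? v x) (adj? w x)))) ⟩
      ∑ V (λ x → 𝟙 (common? v w x))                      ∎
      where open ≡-Reasoning

    -- All neighbours of `v` lie on the opposite side, so restricting to that side loses no common
    -- neighbour.
    codegree-side : ∀ {s} v w → side v ≡ s →
      length (filter (common? v w) (sideVertices G (not s))) ≡ codegree v w
    codegree-side {s} v w refl = begin
      length (filter (common? v w) (sideVertices G (not s)))
        ≡⟨ length-filter-∑ (common? v w) (sideVertices G (not s)) ⟩
      ∑ (sideVertices G (not s)) (𝟙 ∘ common? v w)
        ≡⟨ ∑-filter (λ x → side x Bool.≟ not s) V _ ⟩
      ∑ V (λ x → 𝟙 (side x Bool.≟ not s) * 𝟙 (common? v w x))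
        ≡⟨ ∑-cong V (λ x → trans (sym (𝟙-× (side x Bool.≟ not s) (common? v w x)))
             (𝟙-cong ((side x Bool.≟ not s) ×-dec common? v w x) (common? v w x)
               (mk⇔ proj₂ (λ (vx , wx) → Bool.¬-not (bipartite vx ∘ sym) , (vx , wx))))) ⟩
      ∑ V (𝟙 ∘ common? v w)
        ≡⟨ codegree-∑ v w ⟨
      codegree v w ∎
      where open ≡-Reasoning

    -- A common neighbour would be opposite to both `v` and `w`, which forces them onto one side
    -- because there are only two.
    codegree-acrossSides : ∀ v w → side v ≢ side w → codegree v w ≡ 0
    codegree-acrossSides v w v≁w = begin
      codegree v w                ≡⟨ codegree-∑ v w ⟩
      ∑ V (𝟙 ∘ common? v w)
        ≡⟨ ∑-cong V (λ x → 𝟙-no (common? v w x) λ (vx , wx) →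
             v≁w (trans (Bool.¬-not (bipartite vx)) (sym (Bool.¬-not (bipartite wx))))) ⟩
      ∑ V (λ _ → 0)               ≡⟨ ∑-zero V ⟩
      0                           ∎
      where open ≡-Reasoning

    -- Double counting of wedges, by centre on the left and by endpoints on the right. The summand
    -- depends on the endpoints only, so it is repeated once for each possible centre.
    ∑-wedges : ∀ (φ : ℕ → ℕ) →
      ∑ V (λ u → ∑ (unorderedPairs (Γ G u)) (λ (v , w) → φ (codegree v w))) ≡
      ∑ (unorderedPairs V) (λ (v , w) → codegree v w * φ (codegree v w))
    ∑-wedges φ = begin
      ∑ V (λ u → ∑ (unorderedPairs (Γ G u)) (λ (v , w) → φ (codegree v w)))
        ≡⟨ ∑-cong V (λ u → ∑-pairs-filter (adj? u) V _) ⟩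
      ∑ V (λ u → ∑ (unorderedPairs V) (λ (v , w) → 𝟙 (adj? u v ×-dec adj? u w) * φ (codegree v w)))
        ≡⟨ ∑-swap V (unorderedPairs V) _ ⟩
      ∑ (unorderedPairs V) (λ (v , w) → ∑ V (λ u → 𝟙 (adj? u v ×-dec adj? u w) * φ (codegree v w)))
        ≡⟨ ∑-cong (unorderedPairs V) (λ (v , w) → trans
             (∑-*ʳ (φ (codegree v w)) V _)
             (cong (_* φ (codegree v w)) (trans
               (∑-cong V (λ u → 𝟙-cong (adj? u v ×-dec adj? u w) (common? v w u)
                 (mk⇔ (λ (uv , uw) → adj-sym uv , adj-sym uw) (λ (vu , wu) → adj-sym vu , adj-sym wu))))
               (sym (codegree-∑ v w))))) ⟩
      ∑ (unorderedPairs V) (λ (v , w) → codegree v w * φ (codegree v w)) ∎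
      where open ≡-Reasoning

    -- Butterflies over a fixed pair of vertices on one side.

    private
      isBiclique? = all? (uncurry adj?) ∘ quadEdges
      quads = cartesianProduct (unorderedPairs (sideVertices G false)) (unorderedPairs (sideVertices G true))

    -- The pair p stays fixed on side s while q varies over the opposite side; quad
    -- only restores the orientation that Quad demands.

    module FixedPair
      (s : Bool)
      (quad : Fin n × Fin n → Fin n × Fin n → Quad n)
      -- The four adjacencies are grouped by the vertices of the varying pair, the shape that
      -- `filter-unorderedPairs` expects.
      (biclique⇔ : ∀ {v w x y} → All (uncurry Adj) (quadEdges (quad (v , w) (x , y))) ⇔
                                 ((Adj v x × Adj w x) × (Adj v y × Adj w y)))
      (∑-quads : ∀ f → ∑ (unorderedPairs (sideVertices G s)) (λ p →
                         ∑ (unorderedPairs (sideVertices G (not s))) (f ∘ quad p)) ≡ ∑ quads f)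
      -- Only an inequality, since the pairs of quadruples on the right may differ on side `s`.
      (∑-quadPairs : ∀ f → ∑ (unorderedPairs (sideVertices G s)) (λ p →
                             ∑ (unorderedPairs (unorderedPairs (sideVertices G (not s)))) (λ (q , q′) →
                               f (quad p q , quad p q′))) ≤ ∑ (unorderedPairs quads) f)
      (sharesWedge : ∀ {v w x y q} → x ≢ v × x ≢ w → y ≢ v × y ≢ w →
                     commonCount _≟_ (x , y) q ≡ 1 → SharesWedge (quad (v , w) (x , y) , quad (v , w) q))
      where

      private
        S  = sideVertices G s
        S′ = sideVertices G (not s)

        onSide : All (λ (v , w) → side v ≡ s × side w ≡ s) (unorderedPairs S)
        onSide = unorderedPairs⁺ (All⇒AllPairs (All.all-filter (λ v → side v Bool.≟ s) V))

        -- A pair completes `{v , w}` to a butterfly exactly when both of its vertices are common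
        -- neighbours of `v` and `w`.
        completions : ∀ v w → filter (isBiclique? ∘ quad (v , w)) (unorderedPairs S′) ≡
                              unorderedPairs (filter (common? v w) S′)
        completions v w = filter-unorderedPairs (common? v w) (isBiclique? ∘ quad (v , w)) biclique⇔ S′

      -- A butterfly has one pair of vertices on side `s`, and the butterflies over that pair
      -- correspond to the choices of two common neighbours.
      ∑-codegreeC2 : ∑ (unorderedPairs S) (λ (v , w) → codegree v w C 2) ≡ butterflies G
      ∑-codegreeC2 = begin
        ∑ (unorderedPairs S) (λ (v , w) → codegree v w C 2)
          ≡⟨ ∑-cong-local (All.map (λ {(v , w)} (sv , _) → begin
               codegree v w C 2
                 ≡⟨ cong (_C 2) (codegree-side v w sv) ⟨
               length (filter (common? v w) S′) C 2
                 ≡⟨ length-unorderedPairs (filter (common? v w) S′) ⟨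
               length (unorderedPairs (filter (common? v w) S′))
                 ≡⟨ cong length (completions v w) ⟨
               length (filter (isBiclique? ∘ quad (v , w)) (unorderedPairs S′))
                 ≡⟨ length-filter-∑ (isBiclique? ∘ quad (v , w)) (unorderedPairs S′) ⟩
               ∑ (unorderedPairs S′) (𝟙 ∘ isBiclique? ∘ quad (v , w)) ∎) onSide) ⟩
        ∑ (unorderedPairs S) (λ p → ∑ (unorderedPairs S′) (𝟙 ∘ isBiclique? ∘ quad p))
          ≡⟨ ∑-quads (𝟙 ∘ isBiclique?) ⟩
        ∑ quads (𝟙 ∘ isBiclique?)
          ≡⟨ length-filter-∑ isBiclique? quads ⟨
        butterflies G ∎
        where open ≡-Reasoning

      -- Three common neighbours of `v` and `w` yield three butterflies over `{v , w}`, any two of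
      -- which share a wedge. Pairs of butterflies that agree on the other side do not enter the
      -- sum, hence the inequality.
      ∑-codegreeC3 : ∑ (unorderedPairs S) (λ (v , w) → 3 * (codegree v w C 3)) ≤ p₁w G
      ∑-codegreeC3 = begin
        ∑ (unorderedPairs S) (λ (v , w) → 3 * (codegree v w C 3))
          ≤⟨ ∑-mono (All.map (λ {(v , w)} (sv , _) → perPair v w sv) onSide) ⟩
        ∑ (unorderedPairs S) (λ p → ∑ (unorderedPairs (unorderedPairs S′)) (λ (q , q′) →
          f (quad p q , quad p q′)))
          ≤⟨ ∑-quadPairs f ⟩
        ∑ (unorderedPairs quads) f
          ≡⟨ ∑-pairs-filter isBiclique? quads (𝟙 ∘ sharesWedge?) ⟨
        ∑ (unorderedPairs (butterflyList G)) (𝟙 ∘ sharesWedge?)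
          ≡⟨ length-filter-∑ sharesWedge? (unorderedPairs (butterflyList G)) ⟨
        p₁w G ∎
        where
        open ≤-Reasoning
        -- The biclique tests are carried as a factor so that the sum can range over all quadruples,
        -- where `∑-quadPairs` applies. In `h` they are absent because its list is already filtered.
        f : Quad n × Quad n → ℕ
        f (b , b′) = 𝟙 (isBiclique? b ×-dec isBiclique? b′) * 𝟙 (sharesWedge? (b , b′))
        perPair : ∀ v w → side v ≡ s → 3 * (codegree v w C 3) ≤
          ∑ (unorderedPairs (unorderedPairs S′)) (λ (q , q′) → f (quad (v , w) q , quad (v , w) q′))
        perPair v w sv = begin
          3 * (codegree v w C 3)
            ≡⟨ cong (λ k → 3 * (k C 3)) (codegree-side v w sv) ⟨
          3 * (length N C 3)
            ≤⟨ ∑-meetingPairs _≟_ h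
                 (λ {x} {y} {q} x∉ y∉ meet → ≤-reflexive (sym
                   (𝟙-yes (sharesWedge? (quad (v , w) (x , y) , quad (v , w) q)) (sharesWedge x∉ y∉ meet))))
                 -- A common neighbour differs from `v` and from `w` because adjacency is
                 -- irreflexive.
                 (All.map (λ (vx , wx) → (λ { refl → bipartite vx refl }) , (λ { refl → bipartite wx refl }))
                          (All.all-filter (common? v w) S′))
                 (Unique.filter⁺ (common? v w) (Unique.filter⁺ (λ x → side x Bool.≟ not s) (Unique.allFin⁺ n))) ⟩
          ∑ (unorderedPairs (unorderedPairs N)) h
            ≡⟨ cong (λ qs → ∑ (unorderedPairs qs) h) (completions v w) ⟨
          ∑ (unorderedPairs (filter (isBiclique? ∘ quad (v , w)) (unorderedPairs S′))) h
            ≡⟨ ∑-pairs-filter (isBiclique? ∘ quad (v , w)) (unorderedPairs S′) h ⟩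
          _ ∎
          where
          N = filter (common? v w) S′
          h : (Fin n × Fin n) × (Fin n × Fin n) → ℕ
          h (q , q′) = 𝟙 (sharesWedge? (quad (v , w) q , quad (v , w) q′))

    -- The two sides combined.

    private
      L R : List (Fin n × Fin n)
      L = unorderedPairs (sideVertices G false)
      R = unorderedPairs (sideVertices G true)

      bicliqueˡ⇔ : ∀ {v w x y} → All (uncurry Adj) (quadEdges ((v , w) , (x , y))) ⇔
                                 ((Adj v x × Adj w x) × (Adj v y × Adj w y))
      bicliqueˡ⇔ = mk⇔
        (λ { (vx ∷ vy ∷ wx ∷ wy ∷ []) → (vx , wx) , (vy , wy) })
        (λ ((vx , wx) , (vy , wy)) → vx ∷ vy ∷ wx ∷ wy ∷ [])

      bicliqueʳ⇔ : ∀ {v w x y} → All (uncurry Adj) (quadEdges ((x , y) , (v , w))) ⇔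
                                 ((Adj v x × Adj w x) × (Adj v y × Adj w y))
      bicliqueʳ⇔ = mk⇔
        (λ { (xv ∷ xw ∷ yv ∷ yw ∷ []) → (adj-sym xv , adj-sym xw) , (adj-sym yv , adj-sym yw) })
        (λ ((vx , wx) , (vy , wy)) → adj-sym vx ∷ adj-sym wx ∷ adj-sym vy ∷ adj-sym wy ∷ [])

      module Left = FixedPair false _,_ bicliqueˡ⇔
        (λ f → sym (∑-cartesianProduct L R f))
        (λ f → ∑-pairs-equal-fst f L R)
        sharesWedge-fst

      module Right = FixedPair true (λ p q → q , p) bicliqueʳ⇔
        (λ f → trans (∑-swap R L _) (sym (∑-cartesianProduct L R f)))
        (λ f → ∑-pairs-equal-snd f L R)
        sharesWedge-snd

    -- The binomial form of the summand is twice C(c,2) + 3 C(c,3), so the two hypotheses apply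
    -- termwise. They are kept abstract to serve both sides.
    ∑-side≤ : ∀ (xs : List (Fin n × Fin n)) →
      ∑ xs (λ (v , w) → codegree v w C 2) ≡ butterflies G →
      ∑ xs (λ (v , w) → 3 * (codegree v w C 3)) ≤ p₁w G →
      ∑ xs (λ (v , w) → codegree v w * [β]² (codegree v w)) ≤ 2 * (butterflies G + p₁w G)
    ∑-side≤ xs eq le = begin
      ∑ xs (λ (v , w) → codegree v w * [β]² (codegree v w))
        ≡⟨ ∑-cong xs (λ (v , w) → trans (n*[β]² (codegree v w)) (halve (codegree v w C 2) (codegree v w C 3))) ⟩
      ∑ xs (λ (v , w) → 2 * (codegree v w C 2 + 3 * (codegree v w C 3)))
        ≡⟨ trans (∑-*ˡ 2 xs _) (cong (2 *_) (∑-+ xs _ _)) ⟩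
      2 * (∑ xs (λ (v , w) → codegree v w C 2) + ∑ xs (λ (v , w) → 3 * (codegree v w C 3)))
        ≤⟨ *-monoʳ-≤ 2 (+-mono-≤ (≤-reflexive eq) le) ⟩
      2 * (butterflies G + p₁w G) ∎
      where
      open ≤-Reasoning
      halve : ∀ a b → 2 * a + 6 * b ≡ 2 * (a + 3 * b)
      halve = solve-∀

    ∑-wedges-[β]² : ∑ V (λ u → ∑ (unorderedPairs (Γ G u)) (λ (v , w) → [β]² (codegree v w))) ≤
                    4 * (butterflies G + p₁w G)
    ∑-wedges-[β]² = begin
      ∑ V (λ u → ∑ (unorderedPairs (Γ G u)) (λ (v , w) → [β]² (codegree v w)))
        ≡⟨ ∑-wedges [β]² ⟩
      ∑ (unorderedPairs V) g
        -- A pair within one side is kept by exactly one of the two indicators, and a pair across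
        -- the sides has codegree 0 and contributes nothing.
        ≤⟨ ∑-mono (All.universal (λ (v , w) → bySide (side v) (side w) (g (v , w))
             (λ v≁w → cong (λ k → k * [β]² k) (codegree-acrossSides v w v≁w))) (unorderedPairs V)) ⟩
      ∑ (unorderedPairs V) (λ (v , w) → on false v w * g (v , w) + on true v w * g (v , w))
        ≡⟨ ∑-+ (unorderedPairs V) _ _ ⟩
      ∑ (unorderedPairs V) (λ (v , w) → on false v w * g (v , w)) +
      ∑ (unorderedPairs V) (λ (v , w) → on true v w * g (v , w))
        ≡⟨ cong₂ _+_ (∑-pairs-filter (λ v → side v Bool.≟ false) V g)
                     (∑-pairs-filter (λ v → side v Bool.≟ true) V g) ⟨
      ∑ L g + ∑ R g
        ≤⟨ +-mono-≤ (∑-side≤ L Left.∑-codegreeC2 Left.∑-codegreeC3)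
                    (∑-side≤ R Right.∑-codegreeC2 Right.∑-codegreeC3) ⟩
      2 * (butterflies G + p₁w G) + 2 * (butterflies G + p₁w G)
        ≡⟨ *-distribʳ-+ (butterflies G + p₁w G) 2 2 ⟨
      4 * (butterflies G + p₁w G) ∎
      where
      open ≤-Reasoning
      g : Fin n × Fin n → ℕ
      g (v , w) = codegree v w * [β]² (codegree v w)
      on : Bool → Fin n → Fin n → ℕ
      on s v w = 𝟙 ((side v Bool.≟ s) ×-dec (side w Bool.≟ s))
      bySide : ∀ a b k → (a ≢ b → k ≡ 0) →
        k ≤ 𝟙 ((a Bool.≟ false) ×-dec (b Bool.≟ false)) * k + 𝟙 ((a Bool.≟ true) ×-dec (b Bool.≟ true)) * k
      bySide false false k _  = ≤-reflexive (sym (trans (+-identityʳ (k + 0)) (+-identityʳ k)))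
      bySide true  true  k _  = ≤-reflexive (sym (+-identityʳ k))
      bySide false true  k k≡0 = ≤-reflexive (k≡0 λ ())
      bySide true  false k k≡0 = ≤-reflexive (k≡0 λ ())

open import Data.Integer using (+_)
open import Data.Nat using (ℕ; NonZero; _+_)
open import Data.Rational using (_≤_; _*_; _/_)
open +-*-Solver using (solve; _:=_; _:+_; _:*_; :-_; con)

-- Fractions and the embedding of the natural numbers in the rationals.

toℚᵘ-/ : ∀ i n → ℚ.toℚᵘ (i / suc n) ℚᵘ.≃ mkℚᵘ i n
toℚᵘ-/ i n = ℚ.toℚᵘ-fromℚᵘ (mkℚᵘ i n)

/-cross : ∀ i j m n .{{_ : NonZero m}} .{{_ : NonZero n}} → i ℤ.* + n ≡ j ℤ.* + m → i / m ≡ j / n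
/-cross i j (suc m) (suc n) eq = ℚ.fromℚᵘ-cong {mkℚᵘ i m} {mkℚᵘ j n} (*≡* eq)

-- The detour through unnormalised rationals avoids reasoning about greatest common divisors,
-- because there the product is formed componentwise.
/-* : ∀ i j m n .{{_ : NonZero m}} .{{_ : NonZero n}} .{{_ : NonZero (m ℕ.* n)}} →
      (i / m) * (j / n) ≡ (i ℤ.* j) / (m ℕ.* n)
/-* i j (suc m) (suc n) = ℚ.toℚᵘ-injective (begin
  ℚ.toℚᵘ ((i / suc m) * (j / suc n))                 ≈⟨ ℚ.toℚᵘ-homo-* (i / suc m) (j / suc n) ⟩
  ℚ.toℚᵘ (i / suc m) ℚᵘ.* ℚ.toℚᵘ (j / suc n)         ≈⟨ ℚᵘ.*-cong (toℚᵘ-/ i m) (toℚᵘ-/ j n) ⟩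
  mkℚᵘ i m ℚᵘ.* mkℚᵘ j n                             ≈⟨ toℚᵘ-/ (i ℤ.* j) _ ⟨
  ℚ.toℚᵘ ((i ℤ.* j) / (suc m ℕ.* suc n))             ∎)
  where open import Relation.Binary.Reasoning.Setoid ℚᵘ.≃-setoid

ι : ℕ → ℚ
ι k = + k / 1

ι-+ : ∀ m n → ι (m ℕ.+ n) ≡ ι m ℚ.+ ι n
ι-+ m n = ℚ.toℚᵘ-injective (begin
  ℚ.toℚᵘ (ι (m ℕ.+ n))                  ≈⟨ toℚᵘ-/ (+ (m ℕ.+ n)) 0 ⟩
  mkℚᵘ (+ (m ℕ.+ n)) 0                  ≈⟨ *≡* (cong (ℤ._* + 1) (cong₂ ℤ._+_ (ℤ.*-identityʳ (+ m)) (ℤ.*-identityʳ (+ n)))) ⟨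
  mkℚᵘ (+ m) 0 ℚᵘ.+ mkℚᵘ (+ n) 0        ≈⟨ ℚᵘ.+-cong (toℚᵘ-/ (+ m) 0) (toℚᵘ-/ (+ n) 0) ⟨
  ℚ.toℚᵘ (ι m) ℚᵘ.+ ℚ.toℚᵘ (ι n)        ≈⟨ ℚ.toℚᵘ-homo-+ (ι m) (ι n) ⟨
  ℚ.toℚᵘ (ι m ℚ.+ ι n)                  ∎)
  where open import Relation.Binary.Reasoning.Setoid ℚᵘ.≃-setoid

ι-mono : ∀ {m n} → m ℕ.≤ n → ι m ≤ ι n
ι-mono {m} {n} m≤n = ℚ.toℚᵘ-cancel-≤ (begin
  ℚ.toℚᵘ (ι m)   ≃⟨ toℚᵘ-/ (+ m) 0 ⟩
  mkℚᵘ (+ m) 0   ≤⟨ *≤* (ℤ.*-monoʳ-≤-nonNeg (+ 1) (ℤ.+≤+ m≤n)) ⟩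
  mkℚᵘ (+ n) 0   ≃⟨ toℚᵘ-/ (+ n) 0 ⟨
  ℚ.toℚᵘ (ι n)   ∎)
  where open ℚᵘ.≤-Reasoning

-- This allows the squares of β to be summed in ℕ although β itself can be -1.
i*i≡∣i∣² : ∀ i → i ℤ.* i ≡ + (∣ i ∣ ℕ.* ∣ i ∣)
i*i≡∣i∣² (+ n)    = sym (ℤ.pos-* n n)
i*i≡∣i∣² -[1+ n ] = refl

0≤p*p : ∀ p → 0ℚ ≤ p * p
0≤p*p p with ℚ.≤-total 0ℚ p
... | inj₁ 0≤p = ℚ.≤-trans (ℚ.≤-reflexive (sym (ℚ.*-zeroʳ p)))
                           (ℚ.*-monoˡ-≤-nonNeg p {{ℚ.nonNegative 0≤p}} 0≤p)
... | inj₂ p≤0 = ℚ.≤-trans (ℚ.≤-reflexive (sym (ℚ.*-zeroʳ p)))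
                           (ℚ.*-monoˡ-≤-nonPos p {{ℚ.nonPositive p≤0}} p≤0)

-- Expectation and variance of finite distributions.

𝔼-++ : ∀ (μ ν : Dist A) f → 𝔼 (μ ++ ν) f ≡ 𝔼 μ f ℚ.+ 𝔼 ν f
𝔼-++ []            ν f = sym (ℚ.+-identityˡ (𝔼 ν f))
𝔼-++ ((x , p) ∷ μ) ν f =
  trans (cong (p * f x ℚ.+_) (𝔼-++ μ ν f)) (sym (ℚ.+-assoc (p * f x) (𝔼 μ f) (𝔼 ν f)))

𝔼-scale : ∀ p (ν : Dist B) f → 𝔼 (map (λ (y , q) → y , p * q) ν) f ≡ p * 𝔼 ν f
𝔼-scale p []            f = sym (ℚ.*-zeroʳ p)
𝔼-scale p ((y , q) ∷ ν) f = trans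
  (cong₂ ℚ._+_ (ℚ.*-assoc p q (f y)) (𝔼-scale p ν f))
  (sym (ℚ.*-distribˡ-+ p (q * f y) (𝔼 ν f)))

-- The law of total expectation.
𝔼->>= : ∀ (μ : Dist A) (k : A → Dist B) f → 𝔼 (μ >>= k) f ≡ 𝔼 μ (λ x → 𝔼 (k x) f)
𝔼->>= []            k f = refl
𝔼->>= ((x , p) ∷ μ) k f = trans
  (𝔼-++ (map (λ (y , q) → y , p * q) (k x)) (μ >>= k) f)
  (cong₂ ℚ._+_ (𝔼-scale p (k x) f) (𝔼->>= μ k f))

𝔼-return : ∀ (x : A) f → 𝔼 (return x) f ≡ f x
𝔼-return x f = trans (ℚ.+-identityʳ (1ℚ * f x)) (ℚ.*-identityˡ (f x))

-- This moves an expectation back to ℕ: once every term is a natural multiple of one rational `t`,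
-- only a sum of natural numbers remains.
𝔼-weighted : ∀ (g : A → ℚ) xs F φ t → (∀ x → g x * F x ≡ ι (φ x) * t) →
             𝔼 (map (λ x → x , g x) xs) F ≡ ι (∑ xs φ) * t
𝔼-weighted g []       F φ t eq = sym (ℚ.*-zeroˡ t)
𝔼-weighted g (x ∷ xs) F φ t eq = begin
  g x * F x ℚ.+ 𝔼 (map (λ y → y , g y) xs) F  ≡⟨ cong₂ ℚ._+_ (eq x) (𝔼-weighted g xs F φ t eq) ⟩
  ι (φ x) * t ℚ.+ ι (∑ xs φ) * t              ≡⟨ ℚ.*-distribʳ-+ t (ι (φ x)) (ι (∑ xs φ)) ⟨
  (ι (φ x) ℚ.+ ι (∑ xs φ)) * t                ≡⟨ cong (_* t) (ι-+ (φ x) (∑ xs φ)) ⟨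
  ι (∑ (x ∷ xs) φ) * t                        ∎
  where open ≡-Reasoning

-- The factor `length xs / N` cancels the uniform weight, leaving 1/N per element whatever the
-- length. For the empty list both sides are 0, which settles vertices that are the centre of no
-- wedge.
𝔼-uniform : ∀ N .{{_ : NonZero N}} (xs : List A) F φ s → (∀ x → F x ≡ ι (φ x) * s) →
            (+ length xs / N) * 𝔼 (uniform xs) F ≡ ι (∑ xs φ) * ((1ℤ / N) * s)
𝔼-uniform N []          F φ s eq =
  trans (ℚ.*-zeroʳ (+ 0 / N)) (sym (ℚ.*-zeroˡ ((1ℤ / N) * s)))
𝔼-uniform N xs@(_ ∷ _) F φ s eq = begin
  p * 𝔼 (uniform xs) F
    ≡⟨ cong (p *_) (𝔼-weighted (λ _ → r) xs F φ (r * s)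
         (λ x → trans (cong (r *_) (eq x)) (swapˡ r (ι (φ x)) s))) ⟩
  p * (ι (∑ xs φ) * (r * s))
    ≡⟨ regroup p (ι (∑ xs φ)) r s ⟩
  ι (∑ xs φ) * ((p * r) * s)
    ≡⟨ cong (λ q → ι (∑ xs φ) * (q * s)) p*r ⟩
  ι (∑ xs φ) * ((1ℤ / N) * s) ∎
  where
  open ≡-Reasoning
  p = + length xs / N
  r = 1ℤ / length xs
  instance
    N*len≢0 : NonZero (N ℕ.* length xs)
    N*len≢0 = ℕ.m*n≢0 N (length xs)
  swapˡ : ∀ a b c → a * (b * c) ≡ b * (a * c)
  swapˡ = solve 3 (λ a b c → a :* (b :* c) := b :* (a :* c)) refl
  regroup : ∀ a b c d → a * (b * (c * d)) ≡ b * ((a * c) * d)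
  regroup = solve 4 (λ a b c d → a :* (b :* (c :* d)) := b :* ((a :* c) :* d)) refl
  p*r : p * r ≡ 1ℤ / N
  p*r = trans (/-* (+ length xs) 1ℤ N (length xs)) (/-cross (+ length xs ℤ.* 1ℤ) 1ℤ (N ℕ.* length xs) N (begin
    + length xs ℤ.* 1ℤ ℤ.* + N   ≡⟨ cong (ℤ._* + N) (ℤ.*-identityʳ (+ length xs)) ⟩
    + length xs ℤ.* + N          ≡⟨ ℤ.*-comm (+ length xs) (+ N) ⟩
    + N ℤ.* + length xs          ≡⟨ ℤ.pos-* N (length xs) ⟨
    + (N ℕ.* length xs)          ≡⟨ ℤ.*-identityˡ _ ⟨
    1ℤ ℤ.* + (N ℕ.* length xs)   ∎))

-- The shift `a` is arbitrary and the total mass stays symbolic because the induction passes to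
-- tails of the list, whose mean and mass differ from those of the whole.
𝔼-square-shift : ∀ (μ : Dist ℚ) a → 𝔼 μ (λ y → (y ℚ.- a) * (y ℚ.- a)) ≡
  𝔼 μ (λ y → y * y) ℚ.- (a ℚ.+ a) * mean μ ℚ.+ a * a * 𝔼 μ (λ _ → 1ℚ)
𝔼-square-shift []            a = solve 1 (λ a → con 0ℚ :=
  (con 0ℚ :+ :- ((a :+ a) :* con 0ℚ)) :+ a :* a :* con 0ℚ) refl a
𝔼-square-shift ((y , p) ∷ μ) a = trans
  (cong (p * ((y ℚ.- a) * (y ℚ.- a)) ℚ.+_) (𝔼-square-shift μ a))
  (solve 6 (λ p y a s m t →
    p :* ((y :+ :- a) :* (y :+ :- a)) :+ ((s :+ :- ((a :+ a) :* m)) :+ a :* a :* t) :=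
    (p :* (y :* y) :+ s :+ :- ((a :+ a) :* (p :* y :+ m))) :+ a :* a :* (p :* con 1ℚ :+ t))
    refl p y a (𝔼 μ (λ y → y * y)) (mean μ) (𝔼 μ (λ _ → 1ℚ)))

-- For total mass 1 the variance is the second moment minus the squared mean, and the latter is
-- nonnegative.
Var≤secondMoment : ∀ (μ : Dist ℚ) → 𝔼 μ (λ _ → 1ℚ) ≡ 1ℚ → Var μ ≤ 𝔼 μ (λ y → y * y)
Var≤secondMoment μ mass≡1 = begin
  Var μ                                     ≡⟨ 𝔼-square-shift μ m ⟩
  s ℚ.- (m ℚ.+ m) * m ℚ.+ m * m * 𝔼 μ (λ _ → 1ℚ)
                                            ≡⟨ cong (λ t → s ℚ.- (m ℚ.+ m) * m ℚ.+ m * m * t) mass≡1 ⟩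
  s ℚ.- (m ℚ.+ m) * m ℚ.+ m * m * 1ℚ        ≡⟨ collect s m ⟩
  s ℚ.- m * m                               ≤⟨ ℚ.+-monoʳ-≤ s (ℚ.neg-antimono-≤ (0≤p*p m)) ⟩
  s ℚ.- 0ℚ                                  ≡⟨ ℚ.+-identityʳ s ⟩
  s                                         ∎
  where
  open ℚ.≤-Reasoning
  m = mean μ
  s = 𝔼 μ (λ y → y * y)
  collect : ∀ s m → s ℚ.- (m ℚ.+ m) * m ℚ.+ m * m * 1ℚ ≡ s ℚ.- m * m
  collect = solve 2 (λ s m → (s :+ :- ((m :+ m) :* m)) :+ m :* m :* con 1ℚ := s :+ :- (m :* m)) refl

-- Mass and second moment of the estimate.

module _ {n : ℕ} (G : BipartiteGraph n) .{{_ : NonZero (wedges G)}} where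

  private
    N = wedges G
    c = + N / 4
    estimate = λ v w → (β G v w ℤ.* + N) / 4

  -- Every wedge is drawn with probability 1/N, since the chance of its centre is proportional to
  -- the number of wedges there. The hypothesis on `f` splits off a rational factor `r` so that the
  -- sum over wedges can be taken in ℕ.
  𝔼-wSamp : ∀ f (φ : Fin n → Fin n → ℕ) r → (∀ v w → f (estimate v w) ≡ ι (φ v w) * r) →
    𝔼 (wSamp G) f ≡
    ι (∑ (allFin n) (λ u → ∑ (unorderedPairs (Γ G u)) (uncurry φ))) * ((1ℤ / N) * r)
  𝔼-wSamp f φ r eq = trans
    (𝔼->>= (vertexByWedges G) _ f)
    (𝔼-weighted _ (allFin n) _ _ _ λ u → trans
      (cong₂ _*_
        -- The weight of `u` is rewritten as a number of listed pairs, the form that `𝔼-uniform`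
        -- cancels.
        (cong (λ k → + k / N) (sym (length-unorderedPairs (Γ G u))))
        (𝔼->>= (uniform (unorderedPairs (Γ G u))) _ f))
      (𝔼-uniform N (unorderedPairs (Γ G u)) _ (uncurry φ) r λ (v , w) →
        trans (𝔼-return (estimate v w) f) (eq v w)))

  -- For the constant 1 the sum over wedges is their number N, which cancels 1/N.
  mass-wSamp : 𝔼 (wSamp G) (λ _ → 1ℚ) ≡ 1ℚ
  mass-wSamp = begin
    𝔼 (wSamp G) (λ _ → 1ℚ)
      ≡⟨ 𝔼-wSamp (λ _ → 1ℚ) (λ _ _ → 1) 1ℚ (λ _ _ → refl) ⟩
    ι (∑ (allFin n) (λ u → ∑ (unorderedPairs (Γ G u)) (λ _ → 1))) * ((1ℤ / N) * 1ℚ)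
      ≡⟨ cong₂ (λ k q → ι k * q)
           (∑-cong (allFin n) λ u → trans (∑-const 1 (unorderedPairs (Γ G u)))
             (trans (ℕ.*-identityʳ _) (length-unorderedPairs (Γ G u))))
           (ℚ.*-identityʳ (1ℤ / N)) ⟩
    ι N * (1ℤ / N)
      ≡⟨ /-* (+ N) 1ℤ 1 N ⟩
    (+ N ℤ.* 1ℤ) / (1 ℕ.* N)
      ≡⟨ /-cross (+ N ℤ.* 1ℤ) 1ℤ (1 ℕ.* N) 1 (trans (ℤ.*-identityʳ _) (trans (ℤ.*-identityʳ _)
           (trans (cong +_ (sym (ℕ.*-identityˡ N))) (sym (ℤ.*-identityˡ _))))) ⟩
    1ℚ ∎
    where
    open ≡-Reasoning
    instance
      1*N≢0 : NonZero (1 ℕ.* N)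
      1*N≢0 = ℕ.m*n≢0 1 N

  ∑[β]² : ℕ
  ∑[β]² = ∑ (allFin n) (λ u → ∑ (unorderedPairs (Γ G u)) (λ (v , w) → [β]² (codegree G v w)))

  -- The square of the estimate is β² `c` `c` with `c` equal to N/4. The probability 1/N turns one
  -- of the two factors `c` into 1/4.
  secondMoment-wSamp : 𝔼 (wSamp G) (λ y → y * y) ≡ ι ∑[β]² * ((+ 1 / 4) * c)
  secondMoment-wSamp = trans
    (𝔼-wSamp (λ y → y * y) (λ v w → [β]² (codegree G v w)) (c * c) square)
    (cong (ι ∑[β]² *_) (trans (sym (ℚ.*-assoc (1ℤ / N) c c)) (cong (_* c) 1/N*c)))
    where
    open ≡-Reasoning
    instance
      N*4≢0 : NonZero (N ℕ.* 4)
      N*4≢0 = ℕ.m*n≢0 N 4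
    square : ∀ v w → estimate v w * estimate v w ≡ ι ([β]² (codegree G v w)) * (c * c)
    square v w = begin
      estimate v w * estimate v w   ≡⟨ cong₂ _*_ factor factor ⟨
      (b * c) * (b * c)             ≡⟨ solve 2 (λ b c → (b :* c) :* (b :* c) := (b :* b) :* (c :* c)) refl b c ⟩
      (b * b) * (c * c)             ≡⟨ cong (_* (c * c)) (trans (/-* (β G v w) (β G v w) 1 1)
                                         (cong (_/ 1) (i*i≡∣i∣² (β G v w)))) ⟩
      ι ([β]² (codegree G v w)) * (c * c) ∎
      where
      b = β G v w / 1
      factor : b * c ≡ estimate v w
      factor = /-* (β G v w) (+ N) 1 4
    1/N*c : (1ℤ / N) * c ≡ + 1 / 4
    1/N*c = trans (/-* 1ℤ (+ N) N 4) (/-cross (1ℤ ℤ.* + N) 1ℤ (N ℕ.* 4) 4 (begin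
      1ℤ ℤ.* + N ℤ.* + 4       ≡⟨ ℤ.*-assoc 1ℤ (+ N) (+ 4) ⟩
      1ℤ ℤ.* (+ N ℤ.* + 4)     ≡⟨ cong (1ℤ ℤ.*_) (ℤ.pos-* N 4) ⟨
      1ℤ ℤ.* + (N ℕ.* 4)       ∎))

lemma11 : ∀ {n : ℕ} (G : BipartiteGraph n) .{{_ : NonZero (wedges G)}} → Var (wSamp G) ≤ (+ wedges G / 4) * (+ (butterflies G + p₁w G) / 1)
lemma11 {n} G = begin
  Var (wSamp G)                       ≤⟨ Var≤secondMoment (wSamp G) (mass-wSamp G) ⟩
  𝔼 (wSamp G) (λ y → y * y)           ≡⟨ secondMoment-wSamp G ⟩
  ι (∑[β]² G) * (¼ * c)                       ≤⟨ ℚ.*-monoʳ-≤-nonNeg (¼ * c) (ι-mono (∑-wedges-[β]² G)) ⟩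
  ι (4 ℕ.* t) * (¼ * c)               ≡⟨ cong (λ q → q * (¼ * c))
                                           (trans (/-* (+ 4) (+ t) 1 1) (cong (_/ 1) (sym (ℤ.pos-* 4 t)))) ⟨
  -- The 4 collected from the two sides cancels ¼: the product `ι 4 * ¼` evaluates to `1ℚ`.
  (ι 4 * ι t) * (¼ * c)               ≡⟨ solve 3 (λ f t c → (f :* t) :* (con ¼ :* c) := (f :* con ¼) :* (c :* t)) refl (ι 4) (ι t) c ⟩
  1ℚ * (c * ι t)                      ≡⟨ ℚ.*-identityˡ (c * ι t) ⟩
  c * ι t                             ∎
  where
  open ℚ.≤-Reasoning
  c = + wedges G / 4
  ¼ = + 1 / 4
  t = butterflies G + p₁w G
  instance
    ¼c-nonNeg : ℚ.NonNegative (¼ * c)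
    ¼c-nonNeg = ℚ.nonNeg*nonNeg⇒nonNeg ¼ c {{ℚ.normalize-nonNeg (wedges G) 4}}
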